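{- Algorithm Pruned-S-kSSP (described in the context), whose input is a directed non-negatively weighted graph $G=(V,E,\omega)$, a root $r\in V$ and an integer $k>0$, solves the Single-Source Top-$k$ Simple Shortest Paths problem.
   Context: $G=(V,E,\omega)$ is a finite directed non-negatively weighted graph, $E\subseteq V\times V$, $\omega:E\to\mathbb{R}^+$; $N^+(v)=\{u\in V:(v,u)\in E\}$ and $N^-(v)=\{u\in V:(u,v)\in E\}$. A path from $s$ to $t$ is a vertex sequence $P=(s=v_1,\dots,v_\eta=t)$ with $(v_i,v_{i+1})\in E$ for all $i<\eta$; $V(P)$ is its vertex set; it is simple if it has no repeated vertex; its weight is $\omega(P)=\sum_{i=1}^{\eta-1}\omega(v_i,v_{i+1})$. For a path $\Pi$ ending at $v$ and an edge $(v,u)$, $\Pi\oplus(u)$ is $\Pi$ extended by $u$. A collection of top-$k$ simple shortest paths from $r$ to $v$ is a set of pairwise distinct simple paths from $r$ to $v$ that consists of all simple $r$–$v$ paths if there are fewer than $k$ of them, and otherwise consists of exactly $k$ simple $r$–$v$ paths such that every simple $r$–$v$ path not in the set has weight at least that of every path in the set. The Single-Source Top-$k$ Simple Shortest Paths problem asks for such a collection for each $v\in V\setminus\{r\}$. Algorithm Pruned-S-kSSP. Maintain a list $T_v$ for each $v\in V$ (initially empty) and a min-priority queue $PQ$ of paths keyed by weight, initially containing only the trivial path $(r)$ with key $0$. While $PQ\ne\emptyset$ and there is $w\neq r$ with $|T_w|<k$: remove from $PQ$ a path $\Pi=(r,\dots,v)$ of minimum weight; if the procedure $\mathrm{Pruning}(v)$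 does not return true, then for each $u\in N^+(v)\setminus V(\Pi)$ insert $\Pi\oplus(u)$ into $PQ$ with key $\omega(\Pi)+\omega(v,u)$; then, if $|T_v|<k$, add $\Pi$ to $T_v$. The output is the list $T_v$ for each $v\in V\setminus\{r\}$. Procedure $\mathrm{Pruning}(v)$. Write $V(T_x)=\bigcup_{P\in T_x}V(P)$ for the current lists. Start with a FIFO queue $Q$ containing only $v$ and a set $\mathrm{seen}=\{v\}$. While $Q\neq\emptyset$: remove the head $x$ of $Q$; if $|T_x|<k$ and $x\neq r$, return false; for each $u\in N^-(x)$ with $u\notin\mathrm{seen}$, if $u\in V(T_x)$ then append $u$ to $Q$ and add $u$ to $\mathrm{seen}$. If the loop ends, return true. (The intended meaning of the output is: true if and only if all general predecessors of $v$ are saturated, where $x$ is saturated when $|T_x|=k$, the predecessors of a vertex $x$ are the vertices other than $x$ on the paths of its collection, and the general predecessors of $v$ are $v$ and all vertices related to $v$ by the transitive closure of the predecessor relation.)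
   Formalization: Pruning is corrected, since as written it prunes (r) itself: r is exempt from the test |T_x|<k only once T_r is nonempty, and u ranges over all of V(T_x) rather than V(T_x)∩N^-(x), as ties could otherwise lose paths; weights lie in any totally ordered abelian group. -}

module Defs where

open import Level using (Level; _⊔_) renaming (suc to lsuc)
open import Algebra.Bundles using (AbelianGroup)
open import Data.Bool using (Bool; true; false; if_then_else_)
import Data.Bool.Properties as Bool
open import Data.Fin using (Fin)
open import Data.Fin.Properties using (_≟_)
open import Data.List using (List; []; _∷_; _++_; _∷ʳ_; length; filter; mapMaybe; allFin)
open import Data.List.Membership.Propositional using (_∈_; _∉_)
import Data.List.Membership.DecPropositional as DecMembership
open import Data.List.Relation.Unary.All using (All)
open import Data.List.Relation.Unary.Any using (Any; any?; _─_)
open import Data.List.Relation.Unary.Unique.Propositional using (Unique)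
open import Data.Maybe using (Maybe; just; nothing)
open import Data.Nat using (ℕ; _<_; _<?_)
open import Data.Product using (Σ; ∃; _×_; _,_; proj₂)
open import Data.Sum using (_⊎_)
open import Function using (flip)
open import Induction.WellFounded using (Acc)
open import Relation.Binary using (Rel; IsTotalOrder)
open import Relation.Binary.Construct.Closure.ReflexiveTransitive using (Star)
open import Relation.Binary.PropositionalEquality using (_≡_; _≢_; refl)
open import Relation.Nullary using (¬_; Dec; yes; no; does)
open import Relation.Nullary.Decidable using (¬?; _×-dec_)

-- The library has no real numbers.  Weights live in an arbitrary totally
-- ordered abelian group; (ℝ, +, 0, ≤) is the intended instance.
record OrderedAbelianGroup (c ℓ₁ ℓ₂ : Level) : Set (lsuc (c ⊔ ℓ₁ ⊔ ℓ₂)) where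
  infix 4 _≤_
  field
    abelianGroup : AbelianGroup c ℓ₁
  open AbelianGroup abelianGroup public
    renaming (_∙_ to _+_; ε to 0#; _⁻¹ to -_)
  field
    _≤_          : Rel Carrier ℓ₂
    isTotalOrder : IsTotalOrder _≈_ _≤_
    +-monoˡ-≤    : ∀ z {x y} → x ≤ y → x + z ≤ y + z

module _ {c ℓ₁ ℓ₂ : Level} (W : OrderedAbelianGroup c ℓ₁ ℓ₂) where
  open OrderedAbelianGroup W using (Carrier; 0#; _≤_)

  record WeightedDigraph : Set (c ⊔ ℓ₂) where
    field
      n    : ℕ
      edge : Fin n → Fin n → Bool

    V : Set
    V = Fin n

    Edge : V → V → Set
    Edge u v = edge u v ≡ true

    field
      ω             : ∀ u v → Edge u v → Carrier
      ω-nonNegative : ∀ u v (e : Edge u v) → 0# ≤ ω u v e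

module Paths {c ℓ₁ ℓ₂ : Level} (W : OrderedAbelianGroup c ℓ₁ ℓ₂) (G : WeightedDigraph W) where
  open OrderedAbelianGroup W using (Carrier; 0#; _+_; _≤_)
  open WeightedDigraph G public

  -- Edge is proof-irrelevant, so two paths are equal exactly when their
  -- vertex sequences are.
  infixl 5 _⊕⟨_,_⟩
  data Path (s : V) : V → Set where
    trivial   : Path s s
    _⊕⟨_,_⟩ : ∀ {v} → Path s v → (u : V) → Edge v u → Path s u

  -- Listed from the end of the path to its start.
  vertices : ∀ {s v} → Path s v → List V
  vertices {s} trivial        = s ∷ []
  vertices (Π ⊕⟨ u , _ ⟩) = u ∷ vertices Π

  Simple : ∀ {s v} → Path s v → Set
  Simple Π = Unique (vertices Π)

  weight : ∀ {s v} → Path s v → Carrier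
  weight trivial                = 0#
  weight (_⊕⟨_,_⟩ {v} Π u e) = weight Π + ω v u e

  FewerSimplePathsThan : ℕ → V → V → Set
  FewerSimplePathsThan k s v =
    ∀ (Ps : List (Path s v)) → Unique Ps → All Simple Ps → length Ps < k

  record IsTopK (k : ℕ) {s v : V} (Ps : List (Path s v)) : Set ℓ₂ where
    field
      distinct : Unique Ps
      simple   : All Simple Ps
      few      : FewerSimplePathsThan k s v →
                 ∀ (P : Path s v) → Simple P → P ∈ Ps
      many     : ¬ FewerSimplePathsThan k s v →
                 length Ps ≡ k ×
                 (∀ (P : Path s v) → Simple P → P ∉ Ps →
                  ∀ Q → Q ∈ Ps → weight Q ≤ weight P)

module PrunedSkSSP {c ℓ₁ ℓ₂ : Level} (W : OrderedAbelianGroup c ℓ₁ ℓ₂) (G : WeightedDigraph W)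
                   (r : WeightedDigraph.V G) (k : ℕ) where
  open OrderedAbelianGroup W using (_≤_)
  open Paths W G public

  _∈?_ : (u : V) (us : List V) → Dec (u ∈ us)
  _∈?_ = DecMembership._∈?_ _≟_

  Lists : Set
  Lists = ∀ v → List (Path r v)

  module _ (T : Lists) where

    -- u ∈ V(T_x)
    OnListOf : V → V → Set
    OnListOf x u = Any (λ P → u ∈ vertices P) (T x)

    onListOf? : ∀ x u → Dec (OnListOf x u)
    onListOf? x u = any? (λ P → u ∈? vertices P) (T x)

    -- The root has just one simple path, the trivial one, so it never holds k
    -- paths when k > 1; it is exempt from the size test as soon as that path
    -- is recorded.  It is not exempt before, as otherwise the initial path (r)
    -- would itself be pruned and nothing would ever be explored.
    Unsaturated : V → Set
    Unsaturated x = length (T x) < k × (x ≢ r ⊎ T x ≡ [])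

    -- Ranges over all predecessors of x, i.e. all of V(T_x).  Restricting u to
    -- in-neighbours of x could miss unsaturated general predecessors when
    -- several paths have equal weight, and then needed paths are pruned.
    discovered : V → List V → List V
    discovered x seen = filter (λ u → ¬? (u ∈? seen) ×-dec onListOf? x u) (allFin n)

    -- PruningLoop Q seen b: the loop entered with queue Q (head first) and set
    -- seen terminates and returns b.
    data PruningLoop : List V → List V → Bool → Set where
      exhausted : ∀ {seen} → PruningLoop [] seen true
      refused   : ∀ {x Q seen} → Unsaturated x → PruningLoop (x ∷ Q) seen false
      visit     : ∀ {x Q seen b} → ¬ Unsaturated x →
                  PruningLoop (Q ++ discovered x seen) (seen ++ discovered x seen) b →
                  PruningLoop (x ∷ Q) seen b

    Pruning : V → Bool → Set
    Pruning v b = PruningLoop (v ∷ []) (v ∷ []) b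

  extendBy : ∀ {v} → Path r v → V → Maybe (∃ (Path r))
  extendBy {v} Π u with edge v u Bool.≟ true | u ∈? vertices Π
  ... | yes e | no _ = just (u , Π ⊕⟨ u , e ⟩)
  ... | _     | _    = nothing

  extensions : ∀ {v} → Path r v → List (∃ (Path r))
  extensions Π = mapMaybe (extendBy Π) (allFin n)

  add : Lists → ∀ {v} → Path r v → Lists
  add T {v} Π w with v ≟ w
  ... | yes refl = if does (length (T v) <? k) then T v ∷ʳ Π else T v
  ... | no _     = T w

  record State : Set where
    constructor ⟨_,_⟩
    field
      T  : Lists
      PQ : List (∃ (Path r))

  initial : State
  initial = ⟨ (λ _ → []) , (r , trivial) ∷ [] ⟩

  Running : State → Set
  Running ⟨ T , PQ ⟩ = PQ ≢ [] × ∃ λ w → w ≢ r × length (T w) < k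

  -- One iteration of the main loop.  Ties between paths of minimum weight are
  -- broken arbitrarily, so this is a relation.
  infix 4 _⟶_ _⟶*_
  data _⟶_ : State → State → Set ℓ₂ where
    iterate : ∀ {T PQ v Π b} →
              Running ⟨ T , PQ ⟩ →
              (i : (v , Π) ∈ PQ) →
              All (λ q → weight Π ≤ weight (proj₂ q)) PQ →
              Pruning T v b →
              ⟨ T , PQ ⟩ ⟶ ⟨ add T Π , (if b then [] else extensions Π) ++ (PQ ─ i) ⟩

  _⟶*_ : State → State → Set ℓ₂
  _⟶*_ = Star _⟶_

  record SolvesTopKSimpleShortestPaths : Set ℓ₂ where
    field
      terminates   : Acc (flip _⟶_) initial
      neverStuck   : ∀ s → initial ⟶* s → Running s → Σ State (s ⟶_)
      outputsTopK  : ∀ s → initial ⟶* s → ¬ Running s →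
                     ∀ v → v ≢ r → IsTopK k (State.T s v)

{-# OPTIONS --safe #-}
-- Let T_v be not yet full, and let P be a simple path to v.  Then P is in T_v
-- or some queued path is at most as heavy as P.  For suppose that the longest
-- explored prefix Π of P was pruned.  At that time the general predecessors of
-- its end formed a set S of full vertices, containing with each vertex all
-- vertices on its recorded paths.  Let y be the last vertex of P in S.  The part
-- of P after y avoids S, so it continues each of the k paths recorded at y to a
-- simple path; none of these is heavier than P, because recorded paths were
-- extracted before Π and extraction is in order of weight.  Paths are recorded
-- only where pruning fails, so all k recorded paths have been expanded, and
-- induction on the length of the unexplored part applies to the k new paths: one
-- of them is bounded by a queued path, or all are in T_v, which is then full.

module Submission where

open import Defs
open import Axiom.UniquenessOfIdentityProofs.WithK using (uip)
open import Data.Bool using (Bool; true; false; if_then_else_)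
import Data.Bool.Properties as Bool
open import Data.Empty using (⊥-elim)
open import Data.Fin.Properties using (_≟_)
open import Data.List using (List; []; _∷_; _++_; _∷ʳ_; length; map; mapMaybe; allFin)
import Data.List.Extrema as Extrema
open import Data.List.Membership.Propositional using (_∈_; _∉_; lose; find)
open import Data.List.Membership.Propositional.Properties
  using (∈-++⁺ˡ; ∈-++⁺ʳ; ∈-++⁻; ∈-filter⁺; ∈-filter⁻; ∈-allFin; ∈-map⁻)
open import Data.List.Properties using (length-++; length-map; length-mapMaybe; length-tabulate; map-++)
open import Data.List.Relation.Unary.All as All using (All; []; _∷_)
import Data.List.Relation.Unary.All.Properties as All
open import Data.List.Relation.Unary.AllPairs using ([]; _∷_)
open import Data.List.Relation.Unary.Any as Any using (Any; here; there; any?; _─_)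
open import Data.List.Relation.Unary.Unique.Propositional using (Unique)
import Data.List.Relation.Unary.Unique.Propositional.Properties as Unique
open import Data.Maybe using (Maybe; just; nothing)
open import Data.Nat as ℕ using (ℕ; zero; suc; _<_; _<?_; _^_; _∸_; s≤s; z≤n)
open import Data.Nat.Induction using (<-wellFounded)
open import Data.Nat.ListAction using (sum)
open import Data.Nat.ListAction.Properties using (sum-++)
import Data.Nat.Properties as ℕ
open import Data.Product using (Σ; ∃; _×_; _,_; proj₁; proj₂)
open import Data.Sum using (_⊎_; inj₁; inj₂; [_,_]′)
import Data.Sum as Sum
open import Data.Unit using (⊤; tt)
open import Function using (_∘_; id; flip)
open import Induction.WellFounded using (Acc; acc)
open import Level using (Level; _⊔_)
open import Relation.Binary.Bundles using (TotalOrder)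
open import Relation.Binary.Construct.Closure.ReflexiveTransitive using (ε; _◅_)
open import Relation.Binary.PropositionalEquality
  using (_≡_; _≢_; refl; sym; trans; cong; subst)
open import Relation.Binary.Structures using (IsTotalOrder)
open import Relation.Nullary using (¬_; Dec; yes; no; ofʸ; ofⁿ; contradiction)
open import Relation.Nullary.Decidable using (¬?; _×-dec_; _⊎-dec_)

module _ {a} {A : Set a} where

  ∈-─⁺ : ∀ {x y : A} {xs} (i : x ∈ xs) → y ∈ xs → y ≡ x ⊎ y ∈ (xs ─ i)
  ∈-─⁺ (here refl) (here refl) = inj₁ refl
  ∈-─⁺ (here refl) (there j)   = inj₂ j
  ∈-─⁺ (there i)   (here refl) = inj₂ (here refl)
  ∈-─⁺ (there i)   (there j)   = Sum.map₂ there (∈-─⁺ i j)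

  ∈-─⁻ : ∀ {x y : A} {xs} (i : x ∈ xs) → y ∈ (xs ─ i) → y ∈ xs
  ∈-─⁻ (here refl) j           = there j
  ∈-─⁻ (there i)   (here refl) = here refl
  ∈-─⁻ (there i)   (there j)   = there (∈-─⁻ i j)

  Unique-─ : ∀ {x : A} {xs} (i : x ∈ xs) → Unique xs → Unique (xs ─ i)
  Unique-─ (here _)  (_ ∷ u) = u
  Unique-─ (there i) (p ∷ u) = All.─⁺ i p ∷ Unique-─ i u

  ∉-─ : ∀ {x : A} {xs} (i : x ∈ xs) → Unique xs → x ∉ (xs ─ i)
  ∉-─ (here refl) u       j           = Unique.Unique[x∷xs]⇒x∉xs u j
  ∉-─ (there i)   (p ∷ u) (here refl) = All.lookup p i refl
  ∉-─ (there i)   (p ∷ u) (there j)   = ∉-─ i u j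

  length-─ : ∀ {x : A} {xs} (i : x ∈ xs) → length xs ≡ suc (length (xs ─ i))
  length-─ (here _)           = refl
  length-─ {xs = _ ∷ _} (there i) = cong suc (length-─ i)

  sum-map-─ : ∀ (f : A → ℕ) {x xs} (i : x ∈ xs) →
              sum (map f xs) ≡ f x ℕ.+ sum (map f (xs ─ i))
  sum-map-─ f (here refl) = refl
  sum-map-─ f {x} {y ∷ xs} (there i) rewrite sum-map-─ f i
    | sym (ℕ.+-assoc (f y) (f x) (sum (map f (xs ─ i))))
    | ℕ.+-comm (f y) (f x) = ℕ.+-assoc (f x) (f y) _

  *-sum-map-≤ : ∀ (f : A → ℕ) m {b} xs → All (λ x → m ℕ.* f x ℕ.≤ b) xs →
                m ℕ.* sum (map f xs) ℕ.≤ length xs ℕ.* b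
  *-sum-map-≤ f m []       []       = ℕ.≤-reflexive (ℕ.*-zeroʳ m)
  *-sum-map-≤ f m (x ∷ xs) (p ∷ ps) =
    ℕ.≤-trans (ℕ.≤-reflexive (ℕ.*-distribˡ-+ m (f x) _)) (ℕ.+-mono-≤ p (*-sum-map-≤ f m xs ps))

  Unique⇒length≤ : ∀ {xs ys : List A} → Unique xs → (∀ {x} → x ∈ xs → x ∈ ys) →
                   length xs ℕ.≤ length ys
  Unique⇒length≤ []      xs⊆ys = z≤n
  Unique⇒length≤ {x ∷ xs} {ys} (p ∷ u) xs⊆ys =
    subst (suc (length xs) ℕ.≤_) (sym (length-─ i)) (s≤s (Unique⇒length≤ u xs⊆ys─i))
    where
    i = xs⊆ys (here refl)
    xs⊆ys─i : ∀ {y} → y ∈ xs → y ∈ (ys ─ i)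
    xs⊆ys─i j with ∈-─⁺ i (xs⊆ys (there j))
    ... | inj₁ refl = contradiction j (Unique.Unique[x∷xs]⇒x∉xs (p ∷ u))
    ... | inj₂ j′   = j′

  Unique-∷ʳ : ∀ {xs} {x : A} → Unique xs → x ∉ xs → Unique (xs ∷ʳ x)
  Unique-∷ʳ u x∉xs = Unique.++⁺ u ([] ∷ []) λ { (j , here refl) → x∉xs j }

  All-⊎ : ∀ {p q} {P : A → Set p} {Q : Set q} {xs} → All (λ x → P x ⊎ Q) xs → All P xs ⊎ Q
  All-⊎ []              = inj₁ []
  All-⊎ (inj₂ q ∷ ps)   = inj₂ q
  All-⊎ (inj₁ p ∷ ps)   = Sum.map₁ (p ∷_) (All-⊎ ps)

  module _ {b} {B : Set b} (f : A → Maybe B) where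

    ∈-mapMaybe⁺ : ∀ {x y xs} → x ∈ xs → f x ≡ just y → y ∈ mapMaybe f xs
    ∈-mapMaybe⁺ (here refl) eq rewrite eq = here refl
    ∈-mapMaybe⁺ {xs = z ∷ _} (there i) eq with f z
    ... | just _  = there (∈-mapMaybe⁺ i eq)
    ... | nothing = ∈-mapMaybe⁺ i eq

    ∈-mapMaybe⁻ : ∀ {y} xs → y ∈ mapMaybe f xs → ∃ λ x → x ∈ xs × f x ≡ just y
    ∈-mapMaybe⁻ (x ∷ xs) i with f x in eq
    ∈-mapMaybe⁻ (x ∷ xs) (here refl) | just _ = x , here refl , eq
    ∈-mapMaybe⁻ (x ∷ xs) (there i)   | just _ =
      let z , j , eq′ = ∈-mapMaybe⁻ xs i in z , there j , eq′
    ∈-mapMaybe⁻ (x ∷ xs) i           | nothing =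
      let z , j , eq′ = ∈-mapMaybe⁻ xs i in z , there j , eq′

    Unique-mapMaybe : (∀ {x x′ y} → f x ≡ just y → f x′ ≡ just y → x ≡ x′) →
                      ∀ {xs} → Unique xs → Unique (mapMaybe f xs)
    Unique-mapMaybe inj []                = []
    Unique-mapMaybe inj {x ∷ xs} (p ∷ u) with f x in eq
    ... | nothing = Unique-mapMaybe inj u
    ... | just y  = All.tabulate y≢ ∷ Unique-mapMaybe inj u
      where
      y≢ : ∀ {z} → z ∈ mapMaybe f xs → y ≢ z
      y≢ i refl with x′ , j , eq′ ← ∈-mapMaybe⁻ xs i = All.lookup p j (inj eq eq′)

module Correctness {c ℓ₁ ℓ₂ : Level} (W : OrderedAbelianGroup c ℓ₁ ℓ₂) (G : WeightedDigraph W)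
                   (r : WeightedDigraph.V G) (k : ℕ) (0<k : 0 < k) where
  open OrderedAbelianGroup W
    using (Carrier; 0#; _+_; isTotalOrder; +-monoˡ-≤; identityˡ; comm)
    renaming (_≤_ to _≼_)
  open IsTotalOrder isTotalOrder using (≤-respˡ-≈; ≤-respʳ-≈)
    renaming (refl to ≼-refl; trans to ≼-trans)
  open PrunedSkSSP W G r k
  open State

  x≼x+y : ∀ x {y} → 0# ≼ y → x ≼ x + y
  x≼x+y x 0≼y = ≤-respʳ-≈ (comm _ x) (≤-respˡ-≈ (identityˡ x) (+-monoˡ-≤ x 0≼y))

  Pathʳ : Set
  Pathʳ = ∃ (Path r)

  weightʳ : Pathʳ → Carrier
  weightʳ q = weight (proj₂ q)

  start∈vertices : ∀ {s v} (P : Path s v) → s ∈ vertices P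
  start∈vertices trivial        = here refl
  start∈vertices (P ⊕⟨ u , e ⟩) = there (start∈vertices P)

  simple-cycle-trivial : ∀ {s} (P : Path s s) → Simple P → P ≡ trivial
  simple-cycle-trivial trivial        _ = refl
  simple-cycle-trivial (P ⊕⟨ u , e ⟩) u! =
    contradiction (start∈vertices P) (Unique.Unique[x∷xs]⇒x∉xs u!)

  Unique⇒length≤n : ∀ {vs : List V} → Unique vs → length vs ℕ.≤ n
  Unique⇒length≤n {vs} u = subst (length vs ℕ.≤_) (length-tabulate id) (Unique⇒length≤ u (λ {x} _ → ∈-allFin x))

  -- Suffixes grow at the front, unlike paths: the induction below peels
  -- off the part of a path that has not been explored from its start.
  infixr 5 _∷_
  data Suffix (v : V) : V → Set where
    []  : Suffix v v
    _∷_ : ∀ {x z} → Edge x z → Suffix v z → Suffix v x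

  newVertices : ∀ {v x} → Suffix v x → List V
  newVertices []            = []
  newVertices (_∷_ {z = z} e σ) = z ∷ newVertices σ

  infixl 4.5 _▷_
  _▷_ : ∀ {s v x} → Path s x → Suffix v x → Path s v
  P ▷ []      = P
  P ▷ (e ∷ σ) = (P ⊕⟨ _ , e ⟩) ▷ σ

  Avoids : ∀ {v x} → List V → Suffix v x → Set
  Avoids us []                = ⊤
  Avoids us (_∷_ {z = z} e σ) = z ∉ us × Avoids (z ∷ us) σ

  Avoids-transfer : ∀ {v x us us′} (σ : Suffix v x) → Avoids us σ →
                    (∀ {u} → u ∈ us′ → u ∈ us ⊎ u ∉ newVertices σ) → Avoids us′ σ
  Avoids-transfer []      _       h = tt
  Avoids-transfer (e ∷ σ) (z∉ , a) h =
    (λ z∈ → [ z∉ , (λ z∉′ → z∉′ (here refl)) ]′ (h z∈)) ,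
    Avoids-transfer σ a λ
      { (here refl) → inj₁ (here refl)
      ; (there u∈)  → Sum.map there (_∘ there) (h u∈) }

  ▷-injective : ∀ {s v x} (σ : Suffix v x) {P Q : Path s x} → P ▷ σ ≡ Q ▷ σ → P ≡ Q
  ▷-injective []      eq = eq
  ▷-injective (e ∷ σ) eq with refl ← ▷-injective σ eq = refl

  weight-▷ : ∀ {s v x} (P : Path s x) (σ : Suffix v x) → weight P ≼ weight (P ▷ σ)
  weight-▷ P []      = ≼-refl
  weight-▷ P (e ∷ σ) = ≼-trans (x≼x+y _ (ω-nonNegative _ _ e)) (weight-▷ (P ⊕⟨ _ , e ⟩) σ)

  ▷-mono : ∀ {s v x} {P Q : Path s x} (σ : Suffix v x) → weight P ≼ weight Q →
           weight (P ▷ σ) ≼ weight (Q ▷ σ)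
  ▷-mono []      P≼Q = P≼Q
  ▷-mono (e ∷ σ) P≼Q = ▷-mono σ (+-monoˡ-≤ _ P≼Q)

  data Extension {v} (Π : Path r v) : Pathʳ → Set where
    extension : ∀ {u} → u ∉ vertices Π → (e : Edge v u) → Extension Π (u , Π ⊕⟨ u , e ⟩)

  extendBy-just : ∀ {v} (Π : Path r v) u (e : Edge v u) → u ∉ vertices Π →
                  extendBy Π u ≡ just (u , Π ⊕⟨ u , e ⟩)
  extendBy-just {v} Π u e u∉ with edge v u Bool.≟ true | u ∈? vertices Π
  ... | yes e′ | no _   = cong (λ e → just (u , Π ⊕⟨ u , e ⟩)) (uip e′ e)
  ... | yes _  | yes u∈ = contradiction u∈ u∉
  ... | no ¬e  | _      = contradiction e ¬e

  extendBy-just⁻ : ∀ {v} (Π : Path r v) u {q} → extendBy Π u ≡ just q →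
                   Extension Π q × u ≡ proj₁ q
  extendBy-just⁻ {v} Π u eq with edge v u Bool.≟ true | u ∈? vertices Π
  extendBy-just⁻ Π u refl | yes e | no u∉ = extension u∉ e , refl

  ∈-extensions⁺ : ∀ {v} {Π : Path r v} {q} → Extension Π q → q ∈ extensions Π
  ∈-extensions⁺ {Π = Π} (extension {u} u∉ e) =
    ∈-mapMaybe⁺ (extendBy Π) (∈-allFin u) (extendBy-just Π u e u∉)

  ∈-extensions⁻ : ∀ {v} {Π : Path r v} {q} → q ∈ extensions Π → Extension Π q
  ∈-extensions⁻ {Π = Π} i with u , _ , eq ← ∈-mapMaybe⁻ (extendBy Π) (allFin n) i =
    proj₁ (extendBy-just⁻ Π u eq)

  extensions-unique : ∀ {v} (Π : Path r v) → Unique (extensions Π)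
  extensions-unique Π = Unique-mapMaybe (extendBy Π)
    (λ {x} {x′} p q → trans (proj₂ (extendBy-just⁻ Π x p)) (sym (proj₂ (extendBy-just⁻ Π x′ q))))
    (Unique.allFin⁺ n)

  extension-simple : ∀ {v} {Π : Path r v} {q} → Simple Π → Extension Π q → Simple (proj₂ q)
  extension-simple Π! (extension u∉ e) = All.¬Any⇒All¬ _ u∉ ∷ Π!

  extension-weight : ∀ {v} {Π : Path r v} {q} → Extension Π q → weight Π ≼ weightʳ q
  extension-weight (extension _ e) = x≼x+y _ (ω-nonNegative _ _ e)

  inserted : ∀ {v} → Bool → Path r v → List Pathʳ
  inserted b Π = if b then [] else extensions Π

  ∈-inserted⁻ : ∀ {v} b {Π : Path r v} {q} → q ∈ inserted b Π → Extension Π q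
  ∈-inserted⁻ false = ∈-extensions⁻

  inserted-unique : ∀ {v} b (Π : Path r v) → Unique (inserted b Π)
  inserted-unique false = extensions-unique
  inserted-unique true  _ = []

  -- Termination

  SimpleQueue : State → Set
  SimpleQueue s = All (Simple ∘ proj₂) (PQ s)

  step-simpleQueue : ∀ {s t} → s ⟶ t → SimpleQueue s → SimpleQueue t
  step-simpleQueue (iterate {Π = Π} {b} _ i _ _) sq =
    All.++⁺ (All.tabulate (extension-simple {Π = Π} (All.lookup sq i) ∘ ∈-inserted⁻ b)) (All.─⁺ i sq)

  -- A simple path has at most n extensions, each with one vertex more, so
  -- replacing it by its extensions lowers the total potential.
  potential : Pathʳ → ℕ
  potential (_ , Π) = suc n ^ (n ∸ length (vertices Π))

  totalPotential : State → ℕ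
  totalPotential s = sum (map potential (PQ s))

  extension-potential : ∀ {v} {Π : Path r v} {q} → Simple Π → Extension Π q →
                        suc n ℕ.* potential q ≡ potential (v , Π)
  extension-potential {Π = Π} Π! ext@(extension _ _) =
    cong (suc n ^_) (sym (ℕ.+-∸-assoc 1 (Unique⇒length≤n (extension-simple Π! ext))))

  inserted-potential : ∀ {v} b {Π : Path r v} → Simple Π →
                       sum (map potential (inserted b Π)) < potential (v , Π)
  inserted-potential {v} b {Π} Π! = ℕ.*-cancelˡ-< (suc n) _ _ (ℕ.≤-<-trans
    (*-sum-map-≤ potential (suc n) (inserted b Π)
      (All.tabulate (ℕ.≤-reflexive ∘ extension-potential Π! ∘ ∈-inserted⁻ b)))
    (ℕ.*-monoˡ-< (potential (v , Π)) {{ℕ.m^n≢0 (suc n) (n ∸ length (vertices Π))}}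
      (s≤s (few b))))
    where
    few : ∀ b → length (inserted b Π) ℕ.≤ n
    few true  = z≤n
    few false = subst (length (extensions Π) ℕ.≤_) (length-tabulate id)
                  (length-mapMaybe (extendBy Π) (allFin n))

  step-potential : ∀ {s t} → SimpleQueue s → s ⟶ t → totalPotential t < totalPotential s
  step-potential sq (iterate {PQ = PQ} {Π = Π} {b} _ i _ _)
    rewrite map-++ potential (inserted b Π) (PQ ─ i)
          | sum-++ (map potential (inserted b Π)) (map potential (PQ ─ i))
          | sum-map-─ potential i
    = ℕ.+-monoˡ-< _ (inserted-potential b (All.lookup sq i))

  simpleQueue⇒acc : ∀ s → SimpleQueue s → Acc _<_ (totalPotential s) → Acc (flip _⟶_) s
  simpleQueue⇒acc s sq (acc rec) = acc λ {t} s⟶t →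
    simpleQueue⇒acc t (step-simpleQueue s⟶t sq) (rec (step-potential sq s⟶t))

  terminates : Acc (flip _⟶_) initial
  terminates = simpleQueue⇒acc initial (([] ∷ []) ∷ []) (<-wellFounded _)

  -- Pruning

  module _ (T : Lists) where

    unsaturated? : ∀ x → Dec (Unsaturated T x)
    unsaturated? x = (length (T x) <? k) ×-dec (¬? (x ≟ r) ⊎-dec empty? (T x))
      where
      empty? : (Ps : List (Path r x)) → Dec (Ps ≡ [])
      empty? []      = yes refl
      empty? (_ ∷ _) = no λ ()

    private
      fresh? : ∀ x seen u → Dec (u ∉ seen × OnListOf T x u)
      fresh? x seen u = ¬? (u ∈? seen) ×-dec onListOf? T x u

    -- Every visit moves as many vertices into the queue as it moves out of the
    -- unseen ones, and removes one from the queue.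
    pruningLoop-total : ∀ m Q seen → Unique seen → length Q ℕ.+ n ℕ.≤ m ℕ.+ length seen →
                        ∃ (PruningLoop T Q seen)
    pruningLoop-total m [] seen u h = true , exhausted
    pruningLoop-total zero (x ∷ Q) seen u h =
      contradiction (ℕ.≤-trans (s≤s (ℕ.m≤n+m n (length Q))) h) (ℕ.≤⇒≯ (Unique⇒length≤n u))
    pruningLoop-total (suc m) (x ∷ Q) seen u (s≤s h) with unsaturated? x
    ... | yes p = false , refused p
    ... | no ¬p = let b , loop = pruningLoop-total m (Q ++ D) (seen ++ D) u′ h′ in b , visit ¬p loop
      where
      D = discovered T x seen
      u′ = Unique.++⁺ u (Unique.filter⁺ (fresh? x seen) (Unique.allFin⁺ n))
             λ (j , j′) → proj₁ (proj₂ (∈-filter⁻ (fresh? x seen) {xs = allFin n} j′)) j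
      h′ : length (Q ++ D) ℕ.+ n ℕ.≤ m ℕ.+ length (seen ++ D)
      h′ rewrite length-++ Q {D} | length-++ seen {D}
               | ℕ.+-assoc (length Q) (length D) n | ℕ.+-comm (length D) n
               | sym (ℕ.+-assoc (length Q) n (length D))
               | sym (ℕ.+-assoc m (length seen) (length D)) = ℕ.+-monoˡ-≤ (length D) h

    pruning-total : ∀ v → ∃ (Pruning T v)
    pruning-total v = pruningLoop-total n (v ∷ []) (v ∷ []) ([] ∷ [])
      (ℕ.≤-reflexive (ℕ.+-comm 1 n))

    Settled : List V → V → Set
    Settled S y = ¬ Unsaturated T y × (∀ {u} → OnListOf T y u → u ∈ S)

    pruningLoop-sound : ∀ {Q seen} → PruningLoop T Q seen true →
      (∀ {y} → y ∈ seen → y ∈ Q ⊎ Settled seen y) →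
      ∃ λ S → (∀ {y} → y ∈ seen → y ∈ S) × (∀ {y} → y ∈ S → Settled S y)
    pruningLoop-sound {seen = seen} exhausted h = seen , id , λ y∈ → [ (λ ()) , id ]′ (h y∈)
    pruningLoop-sound {x ∷ Q} {seen} (visit ¬p loop) h =
      let S , seen⊆S , settled = pruningLoop-sound loop h′ in S , seen⊆S ∘ ∈-++⁺ˡ , settled
      where
      D = discovered T x seen
      h′ : ∀ {y} → y ∈ seen ++ D → y ∈ Q ++ D ⊎ Settled (seen ++ D) y
      h′ y∈ with ∈-++⁻ seen y∈
      ... | inj₂ y∈D = inj₁ (∈-++⁺ʳ Q y∈D)
      ... | inj₁ y∈seen with h y∈seen
      ...   | inj₁ (there y∈Q)        = inj₁ (∈-++⁺ˡ y∈Q)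
      ...   | inj₂ (¬p′ , closed)     = inj₂ (¬p′ , ∈-++⁺ˡ ∘ closed)
      ...   | inj₁ (here refl)        = inj₂ (¬p , closed)
        where
        closed : ∀ {u} → OnListOf T x u → u ∈ seen ++ D
        closed {u} on with u ∈? seen
        ... | yes u∈ = ∈-++⁺ˡ u∈
        ... | no u∉  = ∈-++⁺ʳ seen (∈-filter⁺ (fresh? x seen) (∈-allFin u) (u∉ , on))

    pruning-sound : ∀ {v} → Pruning T v true → ∃ λ S → v ∈ S × (∀ {y} → y ∈ S → Settled S y)
    pruning-sound loop =
      let S , v⊆S , settled = pruningLoop-sound loop inj₁ in S , v⊆S (here refl) , settled

  -- Progress

  weightOrder : TotalOrder c ℓ₁ ℓ₂
  weightOrder = record { isTotalOrder = isTotalOrder }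

  open Extrema weightOrder using (argmin; argmin-sel; f[argmin]≤f[⊤]; f[argmin]≤f[xs])

  minimum : ∀ q qs → ∃ λ p → p ∈ q ∷ qs × All (λ q′ → weightʳ p ≼ weightʳ q′) (q ∷ qs)
  minimum q qs = argmin weightʳ q qs ,
    [ here , there ]′ (argmin-sel weightʳ q qs) ,
    f[argmin]≤f[⊤] {f = weightʳ} q qs ∷ f[argmin]≤f[xs] {f = weightʳ} q qs

  running⇒step : ∀ s → Running s → Σ State (s ⟶_)
  running⇒step ⟨ T , []     ⟩ (PQ≢[] , _) = contradiction refl PQ≢[]
  running⇒step ⟨ T , q ∷ qs ⟩ running     =
    let (v , Π) , i , Π≼ = minimum q qs
        b , pruning = pruning-total T v
    in _ , iterate running i Π≼ pruning

  -- Invariants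

  data AddResult (T : Lists) {v} (Π : Path r v) : ∀ w → List (Path r w) → Set where
    appended  : length (T v) < k → AddResult T Π v (T v ∷ʳ Π)
    unchanged : ∀ {w} → (v ≡ w → k ℕ.≤ length (T w)) → AddResult T Π w (T w)

  addResult : ∀ (T : Lists) {v} (Π : Path r v) w → AddResult T Π w (add T Π w)
  addResult T {v} Π w with v ≟ w
  ... | no v≢w = unchanged λ v≡w → contradiction v≡w v≢w
  ... | yes refl with length (T v) ℕ.<ᵇ k | ℕ.<ᵇ-reflects-< (length (T v)) k
  ...   | true  | ofʸ p  = appended p
  ...   | false | ofⁿ ¬p = unchanged λ _ → ℕ.≮⇒≥ ¬p

  add-saturated : ∀ (T : Lists) {v} (Π : Path r v) {w} → k ℕ.≤ length (T w) → add T Π w ≡ T w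
  add-saturated T Π {w} k≤ with add T Π w | addResult T Π w
  ... | _ | appended p  = contradiction k≤ (ℕ.<⇒≱ p)
  ... | _ | unchanged _ = refl

  record Saturated (T : Lists) (S : List V) (bound : Carrier) : Set (c ⊔ ℓ₂) where
    field
      saturated : ∀ {y} → y ∈ S → y ≢ r → k ℕ.≤ length (T y)
      closed    : ∀ {y} → y ∈ S → y ≢ r → ∀ {R} → R ∈ T y → ∀ {u} → u ∈ vertices R → u ∈ S
      light     : ∀ {y} → y ∈ S → y ≢ r → ∀ {R} → R ∈ T y → weight R ≼ bound

  Blocked : Lists → ∀ {v} → Path r v → Set (c ⊔ ℓ₂)
  Blocked T {v} Π = v ≢ r × ∃ λ S → v ∈ S × Saturated T S (weight Π)

  blocked-add : ∀ {T v x} (Π : Path r v) (Ξ : Path r x) → Blocked T Ξ → Blocked (add T Π) Ξ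
  blocked-add {T} Π _ (x≢r , S , x∈S , sat) = x≢r , S , x∈S , record
    { saturated = λ y∈ y≢ → subst (λ Ps → k ℕ.≤ length Ps) (sym (same y∈ y≢)) (saturated y∈ y≢)
    ; closed    = λ y∈ y≢ R∈ → closed y∈ y≢ (subst (_ ∈_) (same y∈ y≢) R∈)
    ; light     = λ y∈ y≢ R∈ → light y∈ y≢ (subst (_ ∈_) (same y∈ y≢) R∈)
    }
    where
    open Saturated sat
    same : ∀ {y} → y ∈ S → y ≢ r → add T Π y ≡ T y
    same y∈ y≢ = add-saturated T Π (saturated y∈ y≢)

  Reached : List Pathʳ → List Pathʳ → Pathʳ → Set
  Reached E PQ q = q ∈ E ⊎ q ∈ PQ

  Expanded : List Pathʳ → List Pathʳ → ∀ {v} → Path r v → Set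
  Expanded E PQ Π = ∀ {q} → Extension Π q → Reached E PQ q

  -- E lists the paths extracted so far.
  record Invariant (E : List Pathʳ) (s : State) : Set (c ⊔ ℓ₂) where
    open State s renaming (T to Ts; PQ to Qs)
    field
      simple     : ∀ {q} → Reached E Qs q → Simple (proj₂ q)
      queue!     : Unique Qs
      fresh      : ∀ {q} → q ∈ Qs → q ∉ E
      parent     : ∀ {v} {Π : Path r v} {u e} → Reached E Qs (u , Π ⊕⟨ u , e ⟩) → (v , Π) ∈ E
      root       : Reached E Qs (r , trivial)
      rootFirst  : ∀ {Π} → (r , Π) ∈ Qs → Ts r ≡ []
      sorted     : ∀ {p q} → p ∈ E → q ∈ Qs → weightʳ p ≼ weightʳ q
      extracted  : ∀ {v} {Π : Path r v} → Π ∈ Ts v → (v , Π) ∈ E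
      lists!     : ∀ v → Unique (Ts v)
      bounded    : ∀ v → length (Ts v) ℕ.≤ k
      recorded   : ∀ {v} {Π : Path r v} → (v , Π) ∈ E → length (Ts v) < k → Π ∈ Ts v
      processed  : ∀ {v} {Π : Path r v} → (v , Π) ∈ E → Expanded E Qs Π ⊎ Blocked Ts Π
      expanded   : ∀ {v} {Π : Path r v} → Π ∈ Ts v → Expanded E Qs Π
      ordered    : ∀ {v} → v ≢ r → ∀ P → Simple P →
                   P ∈ Ts v ⊎ All (λ Q → weight Q ≼ weight P) (Ts v)

  initial-invariant : Invariant [] initial
  initial-invariant = record
    { simple    = λ { (inj₂ (here refl)) → [] ∷ [] }
    ; queue!    = [] ∷ []
    ; fresh     = λ _ ()
    ; parent    = λ { (inj₁ ()) ; (inj₂ (here ())) ; (inj₂ (there ())) }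
    ; root      = inj₂ (here refl)
    ; rootFirst = λ _ → refl
    ; sorted    = λ ()
    ; extracted = λ ()
    ; lists!    = λ _ → []
    ; bounded   = λ _ → z≤n
    ; recorded  = λ ()
    ; processed = λ ()
    ; expanded  = λ ()
    ; ordered   = λ _ _ _ → inj₂ []
    }

  module _ {E : List Pathʳ} {s : State} (inv : Invariant E s) where
    open Invariant inv
    open State s renaming (T to Ts; PQ to Qs)

    Covered : ∀ {v} → Path r v → Set ℓ₂
    Covered {v} P = P ∈ Ts v ⊎ Any (λ q → weightʳ q ≼ weight P) Qs

    module _ {v : V} (v≢r : v ≢ r) (|Tv|<k : length (Ts v) < k) where

      -- The rest of the path avoids S, so each of the k paths recorded at x can be
      -- continued by it, at no greater weight.  If all k results were recorded at
      -- v, then v would be full.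
      detour : ∀ {x z} (e : Edge x z) (σ : Suffix v z) →
               (∀ R → Reached E Qs (z , R) → Avoids (vertices R) σ → Covered (R ▷ σ)) →
               ∀ (Π : Path r x) → x ≢ r → ∀ {S w} → Saturated Ts S w → w ≼ weight Π →
               x ∈ S → ¬ Any (_∈ S) (newVertices (e ∷ σ)) →
               Avoids (vertices Π) (e ∷ σ) → Covered (Π ▷ e ∷ σ)
      detour {x} e σ complete-σ Π x≢r sat w≼Π x∈S none a =
        [ ⊥-elim ∘ overfull , inj₂ ]′ (All-⊎ (All.tabulate continue))
        where
        open Saturated sat

        continue : ∀ {R} → R ∈ Ts x →
                   (R ▷ e ∷ σ) ∈ Ts v ⊎ Any (λ q → weightʳ q ≼ weight (Π ▷ e ∷ σ)) Qs
        continue {R} R∈ =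
          let z∉R , a′ = Avoids-transfer (e ∷ σ) a λ u∈ →
                           inj₂ λ u∈σ → none (lose u∈σ (closed x∈S x≢r R∈ u∈))
              R≼Π = ▷-mono {P = R} {Q = Π} (e ∷ σ) (≼-trans (light x∈S x≢r R∈) w≼Π)
          in Sum.map₂ (Any.map (λ q≼ → ≼-trans q≼ R≼Π))
               (complete-σ (R ⊕⟨ _ , e ⟩) (expanded R∈ (extension z∉R e)) a′)

        overfull : ¬ All (λ R → (R ▷ e ∷ σ) ∈ Ts v) (Ts x)
        overfull all∈ = ℕ.<⇒≱ |Tv|<k (ℕ.≤-trans (saturated x∈S x≢r)
          (subst (ℕ._≤ length (Ts v)) (length-map (_▷ e ∷ σ) (Ts x))
            (Unique⇒length≤ (Unique.map⁺ (▷-injective (e ∷ σ)) (lists! x)) map⊆)))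
          where
          map⊆ : ∀ {P} → P ∈ map (_▷ e ∷ σ) (Ts x) → P ∈ Ts v
          map⊆ P∈ with R , R∈ , refl ← ∈-map⁻ (_▷ e ∷ σ) P∈ = All.lookup all∈ R∈

      complete-extracted : ∀ {x} (σ : Suffix v x) (Π : Path r x) → (x , Π) ∈ E →
                           Avoids (vertices Π) σ → Covered (Π ▷ σ)

      complete-reached : ∀ {x} (σ : Suffix v x) (Π : Path r x) → Reached E Qs (x , Π) →
                         Avoids (vertices Π) σ → Covered (Π ▷ σ)

      -- The recursion finds the last vertex of the path in S and detours there.
      complete-blocked : ∀ {x} (σ : Suffix v x) (Π : Path r x) → x ≢ r →
                         ∀ {S w} → Saturated Ts S w → w ≼ weight Π →
                         Any (_∈ S) (x ∷ newVertices σ) →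
                         Avoids (vertices Π) σ → Covered (Π ▷ σ)

      complete-reached σ Π (inj₁ Π∈E)  a = complete-extracted σ Π Π∈E a
      complete-reached σ Π (inj₂ Π∈PQ) a = inj₂ (lose Π∈PQ (weight-▷ Π σ))

      complete-extracted []      Π Π∈E a = inj₁ (recorded Π∈E |Tv|<k)
      complete-extracted (e ∷ σ) Π Π∈E a@(z∉ , a′) =
        [ (λ expands → complete-reached σ (Π ⊕⟨ _ , e ⟩) (expands (extension z∉ e)) a′)
        , (λ (x≢r , _ , x∈S , sat) → complete-blocked (e ∷ σ) Π x≢r sat ≼-refl (here x∈S) a)
        ]′ (processed Π∈E)

      complete-blocked [] Π _ sat _ (here v∈S) _ =
        contradiction (Saturated.saturated sat v∈S v≢r) (ℕ.<⇒≱ |Tv|<k)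
      complete-blocked (e ∷ σ) Π x≢r {S} sat w≼Π some a@(z∉ , a′)
        with any? (_∈? S) (newVertices (e ∷ σ)) | some
      ... | yes some′ | _           = complete-blocked σ (Π ⊕⟨ _ , e ⟩)
              (λ { refl → z∉ (start∈vertices Π) }) sat
              (≼-trans w≼Π (x≼x+y _ (ω-nonNegative _ _ e))) some′ a′
      ... | no none   | there some′ = contradiction some′ none
      ... | no none   | here x∈S    =
        detour e σ (complete-reached σ) Π x≢r sat w≼Π x∈S none a

      complete-▷ : ∀ {x} (P : Path r x) (σ : Suffix v x) → Simple P → Avoids (vertices P) σ →
                   Covered (P ▷ σ)
      complete-▷ trivial        σ _       a = complete-reached σ trivial root a
      complete-▷ (P ⊕⟨ u , e ⟩) σ (u≢ ∷ P!) a = complete-▷ P (e ∷ σ) P! (All.All¬⇒¬Any u≢ , a)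

      complete : ∀ (P : Path r v) → Simple P → Covered P
      complete P P! = complete-▷ P [] P! tt

  module _ {E T PQ v b} {Π : Path r v} (inv : Invariant E ⟨ T , PQ ⟩)
           (i : (v , Π) ∈ PQ) (Π≼ : All (λ q → weight Π ≼ weightʳ q) PQ)
           (pruning : Pruning T v b) where
    open Invariant inv

    private
      E′ PQ′ : List Pathʳ
      E′  = (v , Π) ∷ E
      PQ′ = inserted b Π ++ (PQ ─ i)

      T′ : Lists
      T′ = add T Π

      Π! : Simple Π
      Π! = simple (inj₂ i)

      ∈-PQ′⁻ : ∀ {q} → q ∈ PQ′ → Extension Π q ⊎ q ∈ (PQ ─ i)
      ∈-PQ′⁻ = Sum.map₁ (∈-inserted⁻ b) ∘ ∈-++⁻ (inserted b Π)

      reached⁺ : ∀ {q} → Reached E PQ q → Reached E′ PQ′ q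
      reached⁺ (inj₁ q∈E)  = inj₁ (there q∈E)
      reached⁺ (inj₂ q∈PQ) with ∈-─⁺ i q∈PQ
      ... | inj₁ refl = inj₁ (here refl)
      ... | inj₂ j    = inj₂ (∈-++⁺ʳ (inserted b Π) j)

      expanded⁺ : ∀ {w} {Ξ : Path r w} → Expanded E PQ Ξ → Expanded E′ PQ′ Ξ
      expanded⁺ expands ext = reached⁺ (expands ext)

      reached⁻ : ∀ {q} → Reached E′ PQ′ q → Extension Π q ⊎ Reached E PQ q
      reached⁻ (inj₁ (here refl)) = inj₂ (inj₂ i)
      reached⁻ (inj₁ (there q∈E)) = inj₂ (inj₁ q∈E)
      reached⁻ (inj₂ q∈)          = Sum.map₂ (inj₂ ∘ ∈-─⁻ i) (∈-PQ′⁻ q∈)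

      extension-new : ∀ {q} → Extension Π q → ¬ Reached E PQ q
      extension-new (extension _ _) reached = fresh i (parent reached)

      fresh′ : ∀ {q} → q ∈ PQ′ → q ∉ E′
      fresh′ q∈ q∈E′ with ∈-PQ′⁻ q∈ | q∈E′
      ... | inj₁ ext | here refl = extension-new ext (inj₂ i)
      ... | inj₁ ext | there q∈E = extension-new ext (inj₁ q∈E)
      ... | inj₂ j   | here refl = ∉-─ i queue! j
      ... | inj₂ j   | there q∈E = fresh (∈-─⁻ i j) q∈E

      parent′ : ∀ {x} {Ξ : Path r x} {u e} → Reached E′ PQ′ (u , Ξ ⊕⟨ u , e ⟩) → (x , Ξ) ∈ E′
      parent′ reached with reached⁻ reached
      ... | inj₁ (extension _ _) = here refl
      ... | inj₂ reached′        = there (parent reached′)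

      rootFirst′ : ∀ {Ξ} → (r , Ξ) ∈ PQ′ → T′ r ≡ []
      rootFirst′ q∈ with ∈-PQ′⁻ q∈
      ... | inj₁ (extension r∉ _) = contradiction (start∈vertices Π) r∉
      ... | inj₂ j with T′ r | addResult T Π r
      ...   | _ | unchanged _ = rootFirst (∈-─⁻ i j)
      ...   | _ | appended _
        with refl ← simple-cycle-trivial Π Π!
           | refl ← simple-cycle-trivial _ (simple (inj₂ (∈-─⁻ i j))) =
        contradiction j (∉-─ i queue!)

      sorted′ : ∀ {p q} → p ∈ E′ → q ∈ PQ′ → weightʳ p ≼ weightʳ q
      sorted′ p∈ q∈ with p∈ | ∈-PQ′⁻ q∈
      ... | here refl | inj₁ ext = extension-weight ext
      ... | here refl | inj₂ j   = All.lookup Π≼ (∈-─⁻ i j)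
      ... | there p∈E | inj₁ ext = ≼-trans (sorted p∈E i) (extension-weight ext)
      ... | there p∈E | inj₂ j   = sorted p∈E (∈-─⁻ i j)

      extracted′ : ∀ {w} {Ξ : Path r w} → Ξ ∈ T′ w → (w , Ξ) ∈ E′
      extracted′ {w} Ξ∈ with T′ w | addResult T Π w
      ... | _ | unchanged _ = there (extracted Ξ∈)
      ... | _ | appended _ with ∈-++⁻ (T v) Ξ∈
      ...   | inj₁ Ξ∈T         = there (extracted Ξ∈T)
      ...   | inj₂ (here refl) = here refl

      lists!′ : ∀ w → Unique (T′ w)
      lists!′ w with T′ w | addResult T Π w
      ... | _ | unchanged _ = lists! w
      ... | _ | appended _  = Unique-∷ʳ (lists! v) (fresh i ∘ extracted)

      bounded′ : ∀ w → length (T′ w) ℕ.≤ k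
      bounded′ w with T′ w | addResult T Π w
      ... | _ | unchanged _ = bounded w
      ... | _ | appended p  =
        subst (ℕ._≤ k) (trans (ℕ.+-comm 1 (length (T v))) (sym (length-++ (T v)))) p

      recorded′ : ∀ {w} {Ξ : Path r w} → (w , Ξ) ∈ E′ → length (T′ w) < k → Ξ ∈ T′ w
      recorded′ {w} Ξ∈ l with T′ w | addResult T Π w | Ξ∈
      ... | _ | appended _  | here refl = ∈-++⁺ʳ (T v) (here refl)
      ... | _ | appended p  | there Ξ∈E = ∈-++⁺ˡ (recorded Ξ∈E p)
      ... | _ | unchanged h | here refl = contradiction (h refl) (ℕ.<⇒≱ l)
      ... | _ | unchanged _ | there Ξ∈E = recorded Ξ∈E l

      settled⇒full : ∀ {S} → Settled T S v → k ℕ.≤ length (T v)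
      settled⇒full (¬unsat , _) = ℕ.≮⇒≥ λ l → ¬unsat (l , exempt (v ≟ r))
        where
        exempt : Dec (v ≡ r) → v ≢ r ⊎ T v ≡ []
        exempt (yes refl) = inj₂ (rootFirst i)
        exempt (no v≢r)   = inj₁ v≢r

      settled⇒≢root : ∀ {S} → Settled T S v → v ≢ r
      settled⇒≢root settled refl with T r | rootFirst i | settled⇒full settled
      ... | _ | refl | k≤0 = contradiction 0<k (ℕ.≤⇒≯ k≤0)

      process : ∀ {b} → Pruning T v b →
                Expanded E′ (inserted b Π ++ (PQ ─ i)) Π ⊎ (k ℕ.≤ length (T v) × Blocked T Π)
      process {false} _    = inj₁ λ ext → inj₂ (∈-++⁺ˡ (∈-extensions⁺ ext))
      process {true}  loop with S , v∈S , settled ← pruning-sound T loop =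
        inj₂ (settled⇒full (settled v∈S) , settled⇒≢root (settled v∈S) , S , v∈S , record
          { saturated = λ y∈ y≢r → ℕ.≮⇒≥ λ l → proj₁ (settled y∈) (l , inj₁ y≢r)
          ; closed    = λ y∈ _ R∈ u∈ → proj₂ (settled y∈) (lose R∈ u∈)
          ; light     = λ _ _ R∈ → sorted (extracted R∈) i
          })

      processed′ : ∀ {w} {Ξ : Path r w} → (w , Ξ) ∈ E′ → Expanded E′ PQ′ Ξ ⊎ Blocked T′ Ξ
      processed′ (here refl) = Sum.map₂ (blocked-add Π Π ∘ proj₂) (process pruning)
      processed′ {Ξ = Ξ} (there Ξ∈E) = Sum.map expanded⁺ (blocked-add Π Ξ) (processed Ξ∈E)

      expanded′ : ∀ {w} {Ξ : Path r w} → Ξ ∈ T′ w → Expanded E′ PQ′ Ξ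
      expanded′ {w} Ξ∈ with T′ w | addResult T Π w
      ... | _ | unchanged _ = expanded⁺ (expanded Ξ∈)
      ... | _ | appended p with ∈-++⁻ (T v) Ξ∈
      ...   | inj₁ Ξ∈T = expanded⁺ (expanded Ξ∈T)
      ...   | inj₂ (here refl) with process pruning
      ...     | inj₁ expands  = expands
      ...     | inj₂ (k≤ , _) = contradiction k≤ (ℕ.<⇒≱ p)

      ordered′ : ∀ {w} → w ≢ r → ∀ P → Simple P →
                 P ∈ T′ w ⊎ All (λ Q → weight Q ≼ weight P) (T′ w)
      ordered′ {w} w≢r P P! with T′ w | addResult T Π w
      ... | _ | unchanged _ = ordered w≢r P P!
      ... | _ | appended p with complete inv w≢r p P P! | ordered w≢r P P!
      ...   | inj₁ P∈ | _       = inj₁ (∈-++⁺ˡ P∈)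
      ...   | inj₂ _  | inj₁ P∈ = inj₁ (∈-++⁺ˡ P∈)
      ...   | inj₂ lighter | inj₂ Q≼P with q , q∈ , q≼P ← find lighter =
        inj₂ (All.∷ʳ⁺ Q≼P (≼-trans (All.lookup Π≼ q∈) q≼P))

    step-invariant : Invariant E′ ⟨ T′ , PQ′ ⟩
    step-invariant = record
      { simple    = [ extension-simple Π! , simple ]′ ∘ reached⁻
      ; queue!    = Unique.++⁺ (inserted-unique b Π) (Unique-─ i queue!)
                      λ (q∈ , j) → extension-new (∈-inserted⁻ b q∈) (inj₂ (∈-─⁻ i j))
      ; fresh     = fresh′
      ; parent    = parent′
      ; root      = reached⁺ root
      ; rootFirst = rootFirst′
      ; sorted    = sorted′
      ; extracted = extracted′
      ; lists!    = lists!′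
      ; bounded   = bounded′
      ; recorded  = recorded′
      ; processed = processed′
      ; expanded  = expanded′
      ; ordered   = ordered′
      }

  reachable-invariant : ∀ {s t} → s ⟶* t → ∃ (λ E → Invariant E s) → ∃ λ E → Invariant E t
  reachable-invariant ε inv = inv
  reachable-invariant (iterate _ i Π≼ pruning ◅ steps) (E , inv) =
    reachable-invariant steps (_ , step-invariant inv i Π≼ pruning)

  final⇒topK : ∀ {E s} → Invariant E s → ¬ Running s → ∀ v → v ≢ r → IsTopK k (T s v)
  final⇒topK {s = ⟨ Ts , Qs ⟩} inv stopped v v≢r = record
    { distinct = lists! v
    ; simple   = simple-list
    ; few      = λ few → exhaustive (few (Ts v) (lists! v) simple-list)
    ; many     = λ ¬few → full ¬few , λ P P! P∉ Q Q∈ →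
                   [ (λ P∈ → contradiction P∈ P∉) , (λ Q≼P → All.lookup Q≼P Q∈) ]′ (ordered v≢r P P!)
    }
    where
    open Invariant inv

    simple-list : All Simple (Ts v)
    simple-list = All.tabulate (simple ∘ inj₁ ∘ extracted)

    empty-queue : length (Ts v) < k → ∀ {q} → q ∉ Qs
    empty-queue l q∈ = stopped ((λ { refl → contradiction q∈ λ () }) , v , v≢r , l)

    exhaustive : length (Ts v) < k → ∀ P → Simple P → P ∈ Ts v
    exhaustive l P P! with complete inv v≢r l P P!
    ... | inj₁ P∈      = P∈
    ... | inj₂ lighter = contradiction (proj₁ (proj₂ (find lighter))) (empty-queue l)

    full : ¬ FewerSimplePathsThan k r v → length (Ts v) ≡ k
    full ¬few with ℕ.m≤n⇒m<n∨m≡n (bounded v)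
    ... | inj₂ eq = eq
    ... | inj₁ l  = contradiction
      (λ Ps Ps! simplePs → ℕ.≤-<-trans
        (Unique⇒length≤ Ps! λ {P} P∈ → exhaustive l P (All.lookup simplePs P∈)) l)
      ¬few

theorem3 : ∀ {c ℓ₁ ℓ₂ : Level} (W : OrderedAbelianGroup c ℓ₁ ℓ₂) (G : WeightedDigraph W)
    (r : WeightedDigraph.V G) (k : ℕ) → 0 < k →
    PrunedSkSSP.SolvesTopKSimpleShortestPaths W G r k
theorem3 W G r k 0<k = record
  { terminates  = terminates
  ; neverStuck  = λ s _ → running⇒step s
  ; outputsTopK = λ s steps → let E , inv = reachable-invariant steps (_ , initial-invariant)
                              in final⇒topK inv
  }
  where open Correctness W G r k 0<k
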